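{- There exists a constant $c \ge 25$ such that for every integer $k$ with $5 \le k \le c$ and all integers $p \ge k+2$ and $q \ge k+2$, $$r_k(p,q) \ge (p-1)\cdot\bigl(r_k(p-1,q)-1\bigr)+1.$$
   Context: For integers $k,p,q$, the Ramsey number $r_k(p,q)$ is the smallest integer $N$ such that for every coloring of all $k$-element subsets of $\{1,\dots,N\}$ with the colors red and blue, there exist either $p$ elements of $\{1,\dots,N\}$ all of whose $k$-element subsets are red, or $q$ elements of $\{1,\dots,N\}$ all of whose $k$-element subsets are blue. -}

module Defs where

open import Data.Nat using (ℕ; _≤_)
open import Data.Fin.Subset using (Subset; _⊆_; ∣_∣)
open import Data.Product using (_×_; ∃-syntax)
open import Data.Sum using (_⊎_)
open import Relation.Binary.PropositionalEquality using (_≡_)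

data Colour : Set where
  red blue : Colour

-- The vertex set {1,…,N} is represented by Fin N.
Colouring : (k N : ℕ) → Set
Colouring k N = (e : Subset N) → ∣ e ∣ ≡ k → Colour

Monochromatic : ∀ {k N} → Colouring k N → Colour → Subset N → Set
Monochromatic {k} χ c S = ∀ e (∣e∣≡k : ∣ e ∣ ≡ k) → e ⊆ S → χ e ∣e∣≡k ≡ c

HasMonochromatic : ∀ {k N} → Colouring k N → Colour → ℕ → Set
HasMonochromatic χ c m = ∃[ S ] (∣ S ∣ ≡ m × Monochromatic χ c S)

Ramsey : (k p q N : ℕ) → Set
Ramsey k p q N =
  (χ : Colouring k N) → HasMonochromatic χ red p ⊎ HasMonochromatic χ blue q

-- IsRamseyNumber k p q N expresses r_k(p,q) = N. It is a relation rather than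
-- a function, since defining a function would require a proof of Ramsey's
-- theorem; minimality makes N unique.
record IsRamseyNumber (k p q N : ℕ) : Set where
  field
    ramsey  : Ramsey k p q N
    minimal : ∀ M → Ramsey k p q M → N ≤ M

module Submission where

-- Put b = p - 1 and n = r′ - 1. Given a colouring χ of the k-subsets of an n-set, colour the
-- k-subsets of b disjoint copies ("blocks") of that set as follows. A k-set inside one block gets
-- its colour from χ. Any other k-set is coloured by a function hue of the multiset of its block
-- sizes, a partition of k into at least two parts. If hue is chosen well, a red p-clique or a blue
-- q-clique of the blow-up meets some block in a red (p - 1)-clique or a blue q-clique of χ
-- (blowup-clique). So if the Ramsey property for (p, q) held at some N at most b n, the one for
-- (p - 1, q) would hold at n < r′ (Ramsey-÷), which contradicts the minimality of r′.
--
-- Suppose that a clique S of colour c meets every block in fewer vertices than that. Then S has a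
-- vertex outside each block (blue), respectively at least two vertices outside each block and, as
-- there are only p - 1 blocks, a block with two vertices (red). These conditions survive when S is
-- shrunk to exactly k + 2 vertices (shrink), so the block sizes become a partition of k + 2. Every
-- way to lower the parts by 2 in total that leaves all of them below k is then the partition of a
-- mixed k-subset of S, hence has hue c. The hue is chosen so that this never happens: every
-- partition of k + 2 that is not excluded by the conditions above can be lowered to a mixed
-- partition of k of the colour other than c. This is a finite property of k (Table), decided by
-- enumerating partitions for each k from 5 to 25 (tables).
--
-- The choice of hue rests on the parity of T, the sum of the halves of the parts rounded down.
-- Lowering one part by 2 changes the parity of T; lowering two parts of the same parity by 1 each
-- does not. Among three parts two have the same parity, so colouring by the parity of T deals with
-- most partitions of k + 2. Pairs of parts are coloured by the parity of the smaller part instead.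
-- A further constraint is that (k - 2, 1, 1) has to be blue, since (k - 1, 1) has to be red
-- because of (k + 1, 1), while (k, 1, 1) must not be all red; for this the rule is reversed for
-- partitions into 3, and in one case 4, parts when k is 2 or 3 modulo 4.

open import Data.Bool using (if_then_else_; _∧_)
open import Data.Fin using (Fin; zero; suc)
import Data.Fin.Properties as Fin
open import Data.Fin.Subset using (Subset; inside; outside; _⊆_; ∣_∣; ⊥)
open import Data.Fin.Subset.Properties
  using (drop-∷-⊆; out⊆; in⊆in; ⊥⊆; ∣⊥∣≡0; ∣p∣≤n; ⊆-antisym)
open import Data.List
  using (List; []; _∷_; [_]; _++_; map; foldr; concatMap; replicate; upTo; length)
open import Data.List.Membership.Propositional using (_∈_)
open import Data.List.Membership.Propositional.Properties using (∈-map⁺; ∈-concatMap⁺; ∈-upTo⁺)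
open import Data.List.Relation.Binary.Permutation.Propositional
  using (_↭_; ↭-refl; ↭-trans; ↭-sym; ↭⇒↭ₛ; prep; swap)
  renaming (refl to ↭-id; trans to ↭-comp)
open import Data.List.Relation.Binary.Permutation.Propositional.Properties
  using (map⁺; ++⁺ˡ; shift; shifts; All-resp-↭; Any-resp-↭)
open import Data.List.Relation.Binary.Permutation.Setoid.Properties using (foldr-commMonoid)
open import Data.List.Relation.Binary.Pointwise as Pointwise using (Pointwise; []; _∷_)
open import Data.List.Relation.Unary.All as All using (All; []; _∷_; all?)
import Data.List.Relation.Unary.All.Properties as All
open import Data.List.Relation.Unary.Any as Any using (Any; here; there; any?)
import Data.List.Relation.Unary.Any.Properties as Any
open import Data.Nat
  using (ℕ; zero; suc; _+_; _*_; _∸_; _/_; _%_; _⊓_; _⊔_; ⌊_/2⌋; _≤_; _<_; _≥_; _≤ᵇ_; _≡ᵇ_;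
         z≤n; s≤s; s≤s⁻¹; _≟_; _≤?_; _<?_)
open import Data.Nat.DivMod using (m*n/n≡m; /-monoˡ-≤)
open import Data.Nat.ListAction using (sum)
open import Data.Nat.ListAction.Properties using (sum-++; sum-↭)
open import Data.Nat.Properties
open import Data.Product using (_×_; _,_; proj₁; ∃-syntax)
open import Data.Sum as Sum using (inj₁; inj₂)
open import Data.Vec as Vec using (Vec; []; _∷_; lookup; concat; group; splitAt; _[_]≔_)
open import Data.Vec.Properties
  using (++-injective; lookup∘update; lookup∘update′; lookup-replicate)
open import Data.Vec.Relation.Binary.Pointwise.Inductive as VecPointwise using ([]; _∷_)
open import Function using (_∘_)
open import Relation.Binary.PropositionalEquality
  using (_≡_; _≢_; refl; sym; trans; cong; cong₂; subst; subst₂; setoid)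
open import Relation.Nullary
  using (¬_; Dec; yes; no; contradiction; toWitness; _→-dec_; _×-dec_; ¬?)
open import Defs

-- The colour of a mixed edge

-- Statistics of a list of block sizes: the number of nonempty blocks, the sum of the halved sizes
-- rounded down, and the largest size. All three ignore empty blocks and the order of the blocks.
support halves largest : List ℕ → ℕ
support xs = sum (map (1 ⊓_) xs)
halves  xs = sum (map ⌊_/2⌋ xs)
largest xs = foldr _⊔_ 0 xs

-- Red for even numbers, blue for odd ones.
colourOf : ℕ → Colour
colourOf n = if n % 2 ≡ᵇ 0 then red else blue

-- The colour of a k-set with the given block sizes, not all in one block. With two nonempty blocks,
-- it is red when k minus the larger size, that is the smaller size, is odd. With more, it is given by
-- the parity of halves; the second test, which reverses the colours, holds exactly for 3 nonempty
-- blocks with k congruent to 2 or 3 modulo 4, and for 4 with k congruent to 2.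
hue : ℕ → List ℕ → Colour
hue k xs =
  if support xs ≤ᵇ 2
    then colourOf (suc (k ∸ largest xs))
    else if (2 ≤ᵇ k % 4) ∧ (support xs + k % 4 ≤ᵇ 6)
      then colourOf (suc (halves xs))
      else colourOf (halves xs)

hue-↭ : ∀ k {xs ys} → xs ↭ ys → hue k xs ≡ hue k ys
hue-↭ k p
  rewrite sum-↭ (map⁺ (1 ⊓_) p)
        | sum-↭ (map⁺ ⌊_/2⌋ p)
        | foldr-commMonoid (setoid ℕ) ⊔-0-isCommutativeMonoid (↭⇒↭ₛ p) = refl

_≟ᶜ_ : (c d : Colour) → Dec (c ≡ d)
red  ≟ᶜ red  = yes refl
red  ≟ᶜ blue = no λ ()
blue ≟ᶜ red  = no λ ()
blue ≟ᶜ blue = yes refl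

-- All mixed k-sets (those with fewer than k vertices in each block) inside a set with block sizes s
-- have colour c.
Mono : ℕ → Colour → List ℕ → Set
Mono k c s = ∀ ν → Pointwise _≤_ ν s → sum ν ≡ k → All (_< k) ν → hue k ν ≡ c

mono-≤ : ∀ {k c μ s} → Pointwise _≤_ μ s → Mono k c s → Mono k c μ
mono-≤ μ≤s mono ν ν≤μ = mono ν (Pointwise.transitive ≤-trans ν≤μ μ≤s)

-- A permutation of s carries the lists below s along.
Pointwise-↭ : ∀ {ν s s′} → Pointwise _≤_ ν s → s ↭ s′ → ∃[ ν′ ] (ν ↭ ν′ × Pointwise _≤_ ν′ s′)
Pointwise-↭ ν≤s             ↭-id           = _ , ↭-refl , ν≤s
Pointwise-↭ (x≤y ∷ ν≤s)     (prep y p)   =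
  let ν′ , q , ν′≤s′ = Pointwise-↭ ν≤s p in _ , prep _ q , x≤y ∷ ν′≤s′
Pointwise-↭ (x≤y ∷ u≤v ∷ ν≤s) (swap y v p) =
  let ν′ , q , ν′≤s′ = Pointwise-↭ ν≤s p in _ , swap _ _ q , u≤v ∷ x≤y ∷ ν′≤s′
Pointwise-↭ ν≤s             (↭-comp p p′) =
  let ν′ , q , ν′≤s′ = Pointwise-↭ ν≤s p
      ν″ , q′ , ν″≤s″ = Pointwise-↭ ν′≤s′ p′
  in ν″ , ↭-trans q q′ , ν″≤s″

mono-↭ : ∀ {k c s s′} → s ↭ s′ → Mono k c s → Mono k c s′
mono-↭ {k} s↭s′ mono ν ν≤s′ Σν≡k ν<k =
  let ν′ , ν↭ν′ , ν′≤s = Pointwise-↭ ν≤s′ (↭-sym s↭s′)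
  in trans (hue-↭ k ν↭ν′)
       (mono ν′ ν′≤s (trans (sym (sum-↭ ν↭ν′)) Σν≡k) (All-resp-↭ ν↭ν′ ν<k))

-- Empty blocks may be dropped, because hue k (0 ∷ ν) and hue k ν are equal by computation.
mono-zeros : ∀ {k c} z {μ} → 0 < k → Mono k c (replicate z 0 ++ μ) → Mono k c μ
mono-zeros zero    0<k mono = mono
mono-zeros (suc z) 0<k mono =
  mono-zeros z 0<k (λ ν ν≤s Σν≡k ν<k → mono (0 ∷ ν) (z≤n ∷ ν≤s) Σν≡k (0<k ∷ ν<k))

-- Deleting two vertices from a partition of k + 2

-- All ways of lowering one positive entry by 1; zeros are kept in place.
removals : List ℕ → List (List ℕ)
removals []           = []
removals (zero  ∷ xs) = map (zero ∷_) (removals xs)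
removals (suc x ∷ xs) = (x ∷ xs) ∷ map (suc x ∷_) (removals xs)

removals-≤ : ∀ μ → All (λ ν → Pointwise _≤_ ν μ × suc (sum ν) ≡ sum μ) (removals μ)
removals-≤ []           = []
removals-≤ (zero  ∷ xs) =
  All.map⁺ (All.map (λ (ν≤ , Σν) → z≤n ∷ ν≤ , Σν) (removals-≤ xs))
removals-≤ (suc x ∷ xs) =
  (n≤1+n x ∷ Pointwise.refl ≤-refl , refl) ∷
  All.map⁺ (All.map (λ {ν} (ν≤ , Σν) →
    ≤-refl ∷ ν≤ , trans (sym (+-suc (suc x) (sum ν))) (cong (suc x +_) Σν)) (removals-≤ xs))

-- Some mixed k-set obtained from block sizes μ by deleting two vertices does not have colour c.
Escapes : ℕ → Colour → List ℕ → Set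
Escapes k c μ = Any (λ ν → All (_< k) ν × hue k ν ≢ c) (concatMap removals (removals μ))

escapes⇒¬mono : ∀ {k c μ} → sum μ ≡ 2 + k → Escapes k c μ → ¬ Mono k c μ
escapes⇒¬mono {k} {c} {μ} Σμ≡2+k escapes mono =
  let (ρ≤μ , Σρ) , escapes′ = All.lookupAny (removals-≤ μ) (Any.concatMap⁻ removals escapes)
      (ν≤ρ , Σν) , ν<k , hue≢c = All.lookupAny (removals-≤ _) escapes′
      Σν≡k = suc-injective (suc-injective (trans (cong suc Σν) (trans Σρ Σμ≡2+k)))
  in hue≢c (mono _ (Pointwise.transitive ≤-trans ν≤ρ ρ≤μ) Σν≡k ν<k)

-- Enumeration of partitions

-- The partitions of N into parts between 1 and B, built from the number j of parts equal
-- to the bound.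
partitions : ℕ → ℕ → List (List ℕ)
partitions zero    zero    = [ [] ]
partitions zero    (suc _) = []
partitions (suc B) N =
  concatMap (λ j → map (replicate j (suc B) ++_) (partitions B (N ∸ j * suc B)))
            (upTo (suc (N / suc B)))

-- Move the entries equal to the bound to the front.
extract : ∀ B s → All (_≤ suc B) s →
          ∃[ j ] ∃[ s′ ] (All (_≤ B) s′ × s ↭ replicate j (suc B) ++ s′)
extract B []      []          = 0 , [] , [] , ↭-refl
extract B (x ∷ s) (x≤ ∷ s≤) with extract B s s≤ | x ≟ suc B
... | j , s′ , s′≤ , p | yes refl = suc j , s′ , s′≤ , prep _ p
... | j , s′ , s′≤ , p | no x≢    =
  j , x ∷ s′ , s≤s⁻¹ (≤∧≢⇒< x≤ x≢) ∷ s′≤ ,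
  ↭-trans (prep x p) (↭-sym (shift x (replicate j (suc B)) s′))

sum-replicate : ∀ j x → sum (replicate j x) ≡ j * x
sum-replicate zero    x = refl
sum-replicate (suc j) x = cong (x +_) (sum-replicate j x)

-- Every list with entries at most B is, up to order and zeros, one of the enumerated partitions of
-- its sum.
∈-partitions : ∀ B s → All (_≤ B) s →
               ∃[ μ ] (μ ∈ partitions B (sum s) × ∃[ z ] s ↭ replicate z 0 ++ μ)
∈-partitions zero    []         []          = [] , here refl , 0 , ↭-refl
∈-partitions zero    (zero ∷ s) (z≤n ∷ s≤) =
  let μ , μ∈ , z , p = ∈-partitions zero s s≤ in μ , μ∈ , suc z , prep 0 p
∈-partitions (suc B) s s≤ =
  let j , s′ , s′≤ , p  = extract B s s≤
      μ , μ∈ , z , q    = ∈-partitions B s′ s′≤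
      Bs                = replicate j (suc B)
      Σs = trans (sum-↭ p) (trans (sum-++ Bs s′) (cong (_+ sum s′) (sum-replicate j (suc B))))
      Σs′ = sym (trans (cong (_∸ j * suc B) Σs) (m+n∸m≡n (j * suc B) (sum s′)))
      j≤ = subst (_≤ sum s / suc B) (m*n/n≡m j (suc B))
             (/-monoˡ-≤ (suc B) (subst (j * suc B ≤_) (sym Σs) (m≤m+n _ _)))
      member = ∈-map⁺ (Bs ++_) (subst (λ N → μ ∈ partitions B N) Σs′ μ∈)
  in Bs ++ μ
   , ∈-concatMap⁺ _ (Any.map (λ {refl → member}) (∈-upTo⁺ (s≤s j≤)))
   , z
   , ↭-trans p (↭-trans (++⁺ˡ Bs q) (shifts Bs (replicate z 0)))

-- The finite check and its consequence

-- A clique of colour c and size m in the blow-up has to give a clique of size m - slack c in one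
-- block: p - 1 for red, q for blue. A clique that fails to do so has at least 1 + slack c vertices
-- outside each block, and some block contains more than slack c of its vertices.
slack : Colour → ℕ
slack red  = 1
slack blue = 0

-- The property of hue that makes the blow-up work. The bound on the parts says that at least
-- 1 + slack c of the k + 2 vertices lie outside each block.
Table : ℕ → Colour → Set
Table k c = All (λ μ → Any (slack c <_) μ → Escapes k c μ)
                (partitions (2 + k ∸ suc (slack c)) (2 + k))

table? : ∀ k c → Dec (Table k c)
table? k c =
  all? (λ μ → any? (slack c <?_) μ →-dec
              any? (λ ν → all? (_<? k) ν ×-dec ¬? (hue k ν ≟ᶜ c)) _) _

-- Below s there is a list of any smaller sum.
trim : ∀ t s → t ≤ sum s → ∃[ ν ] (Pointwise _≤_ ν s × sum ν ≡ t)
trim zero []      z≤n = [] , [] , refl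
trim t    (x ∷ s) t≤  =
  let ν , ν≤s , Σν = trim (t ∸ x) s (m≤n+o⇒m∸n≤o t x t≤)
  in x ⊓ t ∷ ν , m⊓n≤m x t ∷ ν≤s , trans (cong (x ⊓ t +_) Σν) (m⊓n+n∸m≡n x t)

all≤sum : ∀ xs → All (_≤ sum xs) xs
all≤sum []       = []
all≤sum (x ∷ xs) = m≤m+n x _ ∷ All.map (λ y≤ → ≤-trans y≤ (m≤n+m _ x)) (all≤sum xs)

-- If one block has at least a vertices and the others together have at least a, then t vertices can
-- be kept so that this stays true; it bounds every kept block by t - a.
shrink : ∀ a t x s → a ≤ x → a ≤ sum s → a + a ≤ t → t ≤ x + sum s →
         ∃[ ν ] (Pointwise _≤_ ν (x ∷ s) × sum ν ≡ t × Any (a ≤_) ν × All (_≤ t ∸ a) ν)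
shrink a t x s a≤x a≤Σ 2a≤t t≤ with ≤-total (sum s) (t ∸ a)
-- The other blocks are small: they are kept whole, and the first block keeps the rest.
... | inj₁ Σ≤ =
  t ∸ sum s ∷ s
  , m≤n+o⇒m∸n≤o t (sum s) (subst (t ≤_) (+-comm x (sum s)) t≤) ∷ Pointwise.refl ≤-refl
  , m∸n+n≡m (≤-trans Σ≤ (m∸n≤m t a))
  , here (subst (_≤ t ∸ sum s) (m∸[m∸n]≡n (m+n≤o⇒m≤o a 2a≤t)) (∸-monoʳ-≤ t Σ≤))
  , ∸-monoʳ-≤ t a≤Σ ∷ All.map (λ y≤ → ≤-trans y≤ Σ≤) (all≤sum s)
-- The other blocks are large: they keep t - a vertices, and the first block keeps a.
... | inj₂ Σ≥ =
  let ν , ν≤s , Σν = trim (t ∸ a) s Σ≥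
  in a ∷ ν
   , a≤x ∷ ν≤s
   , trans (cong (a +_) Σν) (m+[n∸m]≡n (m+n≤o⇒m≤o a 2a≤t))
   , here ≤-refl
   , m+n≤o⇒m≤o∸n a 2a≤t ∷ subst (λ r → All (_≤ r) ν) Σν (all≤sum ν)

sum≤*length : ∀ c s → All (_≤ c) s → sum s ≤ c * length s
sum≤*length c []      []        = z≤n
sum≤*length c (x ∷ s) (x≤ ∷ s≤) =
  subst (x + sum s ≤_) (sym (*-suc c (length s))) (+-mono-≤ x≤ (sum≤*length c s s≤))

pigeonhole : ∀ c s → c * length s < sum s → Any (c <_) s
pigeonhole c s c*l<Σ with any? (c <?_) s
... | yes big = big
... | no ¬big =
  contradiction (sum≤*length c s (All.map ≮⇒≥ (All.¬Any⇒All¬ s ¬big))) (<⇒≱ c*l<Σ)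

-- Bring an entry satisfying P to the front.
pull : ∀ {P : ℕ → Set} {s} → Any P s → ∃[ x ] ∃[ s′ ] (P x × s ↭ x ∷ s′)
pull (here px) = _ , _ , px , ↭-refl
pull {s = y ∷ _} (there i) =
  let x , s′ , px , p = pull i in x , y ∷ s′ , px , ↭-trans (prep y p) (swap y x ↭-refl)

Any-zeros⁻ : ∀ {c} z {μ} → Any (c <_) (replicate z 0 ++ μ) → Any (c <_) μ
Any-zeros⁻ zero    i         = i
Any-zeros⁻ (suc z) (there i) = Any-zeros⁻ z i

-- A set of at least k + 2 vertices with 1 + slack c of them outside each block, and with more vertices
-- than slack c per block on average, contains a mixed k-set that does not have colour c.
¬mono : ∀ {k c s} → 2 ≤ k → Table k c → 2 + k ≤ sum s → slack c * length s < sum s →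
        All (λ x → x + suc (slack c) ≤ sum s) s → ¬ Mono k c s
¬mono {k} {c} {s} 2≤k table 2+k≤Σ large spread mono =
  let a = suc (slack c)
      x , s′ , a≤x , p = pull (pigeonhole (slack c) s large)
      Σs≡ = sum-↭ p
      x+a≤ = subst (x + a ≤_) Σs≡ (All.head (All-resp-↭ p spread))
      ν , ν≤ , Σν , a≤ν , ν≤t∸a =
        shrink a (2 + k) x s′ a≤x (+-cancelˡ-≤ x a (sum s′) x+a≤)
          (≤-trans (a+a≤4 c) (+-monoʳ-≤ 2 2≤k)) (subst (2 + k ≤_) Σs≡ 2+k≤Σ)
      μ , μ∈ , z , q = ∈-partitions (2 + k ∸ a) ν ν≤t∸a
      Σμ = trans (sym (trans (sum-↭ q) (trans (sum-++ (replicate z 0) μ)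
             (cong (_+ sum μ) (trans (sum-replicate z 0) (*-zeroʳ z)))))) Σν
      μ∈′ = subst (λ N → μ ∈ partitions (2 + k ∸ a) N) Σν μ∈
  in escapes⇒¬mono Σμ (All.lookup table μ∈′ (Any-zeros⁻ z (Any-resp-↭ q a≤ν)))
       (mono-zeros z (≤-trans (s≤s z≤n) 2≤k) (mono-↭ q (mono-≤ ν≤ (mono-↭ p mono))))
  where
  a+a≤4 : ∀ c → suc (slack c) + suc (slack c) ≤ 4
  a+a≤4 red  = ≤-refl
  a+a≤4 blue = s≤s (s≤s z≤n)

-- Subsets

private variable
  b k m n p q : ℕ

shrinkSubset : (S : Subset n) → m ≤ ∣ S ∣ → ∃[ e ] (e ⊆ S × ∣ e ∣ ≡ m)
shrinkSubset {n} {zero}  S             _       = ⊥ , ⊥⊆ , ∣⊥∣≡0 n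
shrinkSubset {m = suc m} (outside ∷ S) m≤      =
  let e , e⊆S , ∣e∣ = shrinkSubset S m≤ in outside ∷ e , out⊆ e⊆S , ∣e∣
shrinkSubset {m = suc m} (inside  ∷ S) (s≤s m≤) =
  let e , e⊆S , ∣e∣ = shrinkSubset S m≤ in inside ∷ e , in⊆in e⊆S , cong suc ∣e∣

++-⊆ : {S S′ : Subset m} {T T′ : Subset n} → S ⊆ S′ → T ⊆ T′ → S Vec.++ T ⊆ S′ Vec.++ T′
++-⊆ {S = []}    {[]}     S⊆S′ T⊆T′ x∈ = T⊆T′ x∈
++-⊆ {S = _ ∷ _} {_ ∷ _}  S⊆S′ T⊆T′ Vec.here with Vec.here ← S⊆S′ Vec.here = Vec.here
++-⊆ {S = _ ∷ _} {_ ∷ _}  S⊆S′ T⊆T′ (Vec.there x∈) = Vec.there (++-⊆ (drop-∷-⊆ S⊆S′) T⊆T′ x∈)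

++-⊆⁻ʳ : (S S′ : Subset m) {T T′ : Subset n} → S Vec.++ T ⊆ S′ Vec.++ T′ → T ⊆ T′
++-⊆⁻ʳ []      []       ⊆ = ⊆
++-⊆⁻ʳ (_ ∷ S) (_ ∷ S′) ⊆ = ++-⊆⁻ʳ S S′ (drop-∷-⊆ ⊆)

++-⊆⁻ˡ : (S S′ : Subset m) {T T′ : Subset n} → S Vec.++ T ⊆ S′ Vec.++ T′ → S ⊆ S′
++-⊆⁻ˡ (_ ∷ S) (_ ∷ S′) ⊆ Vec.here with Vec.here ← ⊆ Vec.here = Vec.here
++-⊆⁻ˡ (_ ∷ S) (_ ∷ S′) ⊆ (Vec.there x∈) = Vec.there (++-⊆⁻ˡ S S′ (drop-∷-⊆ ⊆) x∈)

∣++∣ : (S : Subset m) (T : Subset n) → ∣ S Vec.++ T ∣ ≡ ∣ S ∣ + ∣ T ∣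
∣++∣ []            T = refl
∣++∣ (outside ∷ S) T = ∣++∣ S T
∣++∣ (inside  ∷ S) T = cong suc (∣++∣ S T)

∣++⊥∣ : ∀ d (S : Subset n) → ∣ S Vec.++ ⊥ {d} ∣ ≡ ∣ S ∣
∣++⊥∣ d S = trans (∣++∣ S ⊥) (trans (cong (∣ S ∣ +_) (∣⊥∣≡0 d)) (+-identityʳ _))

-- The Ramsey property passes to larger vertex sets: colour the subsets of the first N vertices by
-- padding them with vertices outside.
Ramsey-+ : ∀ {N} d → Ramsey k p q N → Ramsey k p q (N + d)
Ramsey-+ {k} {N = N} d ramsey χ = Sum.map extend extend (ramsey χ↾)
  where
  χ↾ : Colouring k N
  χ↾ e ∣e∣ = χ (e Vec.++ ⊥) (trans (∣++⊥∣ d e) ∣e∣)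

  extend : ∀ {c m} → HasMonochromatic χ↾ c m → HasMonochromatic χ c m
  extend {c} (S , ∣S∣ , mono) = S Vec.++ ⊥ , trans (∣++⊥∣ d S) ∣S∣ , mono′
    where
    mono′ : Monochromatic χ c (S Vec.++ ⊥)
    mono′ e ∣e∣ e⊆ with splitAt N e
    ... | e₁ , e₂ , refl with ⊆-antisym (++-⊆⁻ʳ e₁ S e⊆) ⊥⊆
    ...   | refl = trans (cong (χ _) (≡-irrelevant _ _))
                         (mono e₁ (trans (sym (∣++⊥∣ d e₁)) ∣e∣) (++-⊆⁻ˡ e₁ S e⊆))

-- Blocks

-- A subset of b disjoint copies of Fin n is given by its b blocks; concat assembles them into a subset
-- of Fin (b * n), and group takes it apart again.
sizes : Vec (Subset n) b → List ℕ
sizes []       = []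
sizes (S ∷ Ss) = ∣ S ∣ ∷ sizes Ss

length-sizes : (Ss : Vec (Subset n) b) → length (sizes Ss) ≡ b
length-sizes []       = refl
length-sizes (S ∷ Ss) = cong suc (length-sizes Ss)

All-sizes⁺ : ∀ {P : ℕ → Set} (Ss : Vec (Subset n) b) → (∀ i → P ∣ lookup Ss i ∣) → All P (sizes Ss)
All-sizes⁺ []       f = []
All-sizes⁺ (S ∷ Ss) f = f zero ∷ All-sizes⁺ Ss (f ∘ suc)

All-sizes⁻ : ∀ {P : ℕ → Set} (Ss : Vec (Subset n) b) → All P (sizes Ss) → ∀ i → P ∣ lookup Ss i ∣
All-sizes⁻ (S ∷ Ss) (pS ∷ pSs) zero    = pS
All-sizes⁻ (S ∷ Ss) (pS ∷ pSs) (suc i) = All-sizes⁻ Ss pSs i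

-- Blockwise inclusion.
_⊆ᵇ_ : Vec (Subset n) b → Vec (Subset n) b → Set
es ⊆ᵇ Ss = VecPointwise.Pointwise _⊆_ es Ss

-- Any smaller block sizes are the block sizes of a subset.
realise : (Ss : Vec (Subset n) b) {ν : List ℕ} → Pointwise _≤_ ν (sizes Ss) →
          ∃[ es ] (es ⊆ᵇ Ss × sizes es ≡ ν)
realise []       []          = [] , [] , refl
realise (S ∷ Ss) (m≤ ∷ ν≤) =
  let e  , e⊆  , ∣e∣ = shrinkSubset S m≤
      es , es⊆ , Σes = realise Ss ν≤
  in e ∷ es , e⊆ ∷ es⊆ , cong₂ _∷_ ∣e∣ Σes

∣concat∣ : (Ss : Vec (Subset n) b) → ∣ concat Ss ∣ ≡ sum (sizes Ss)
∣concat∣ []       = refl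
∣concat∣ (S ∷ Ss) = trans (∣++∣ S (concat Ss)) (cong (∣ S ∣ +_) (∣concat∣ Ss))

concat-⊆ : {es Ss : Vec (Subset n) b} → es ⊆ᵇ Ss → concat es ⊆ concat Ss
concat-⊆ []          = λ ()
concat-⊆ (_∷_ {x = e} {y = S} e⊆ es⊆) = ++-⊆ {S = e} {S} e⊆ (concat-⊆ es⊆)

concat-injective : (es es′ : Vec (Subset n) b) → concat es ≡ concat es′ → es ≡ es′
concat-injective []       []         _  = refl
concat-injective (e ∷ es) (e′ ∷ es′) eq =
  let e≡ , es≡ = ++-injective e e′ eq in cong₂ _∷_ e≡ (concat-injective es es′ es≡)

-- The subset whose only nonempty block is e, in position i.
single : Fin b → Subset n → Vec (Subset n) b
single i e = Vec.replicate _ ⊥ [ i ]≔ e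

sum-sizes-single : (i : Fin b) (e : Subset n) → sum (sizes (single i e)) ≡ ∣ e ∣
sum-sizes-single {suc b} {n} zero e = trans (cong (∣ e ∣ +_) (empty b)) (+-identityʳ _)
  where
  empty : ∀ b → sum (sizes (Vec.replicate b (⊥ {n}))) ≡ 0
  empty zero    = refl
  empty (suc b) = cong₂ _+_ (∣⊥∣≡0 n) (empty b)
sum-sizes-single {n = n} (suc i) e = cong₂ _+_ (∣⊥∣≡0 n) (sum-sizes-single i e)

single-⊆ : (i : Fin b) {e : Subset n} (Ss : Vec (Subset n) b) → e ⊆ lookup Ss i → single i e ⊆ᵇ Ss
single-⊆ zero    (S ∷ Ss) e⊆ = e⊆ ∷ empty Ss
  where
  empty : ∀ {b n} (Ss : Vec (Subset n) b) → Vec.replicate b ⊥ ⊆ᵇ Ss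
  empty []       = []
  empty (S ∷ Ss) = ⊥⊆ ∷ empty Ss
single-⊆ (suc i) (S ∷ Ss) e⊆ = ⊥⊆ ∷ single-⊆ i Ss e⊆

-- The blow-up colouring

-- An edge lies inside one block exactly when some block has k elements; it then takes the colour of
-- that block, and otherwise the hue of its block sizes.
blockColour : Colouring k n → Vec (Subset n) b → Colour
blockColour {k} χ es with Fin.any? (λ i → ∣ lookup es i ∣ ≟ k)
... | yes (i , ∣e∣) = χ (lookup es i) ∣e∣
... | no  _         = hue k (sizes es)

blowup : ∀ b → Colouring k n → Colouring k (b * n)
blowup {n = n} b χ e _ = blockColour χ (proj₁ (group b n e))

blowup-concat : (χ : Colouring k n) (es : Vec (Subset n) b) (∣e∣ : ∣ concat es ∣ ≡ k) →
                blowup b χ (concat es) ∣e∣ ≡ blockColour χ es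
blowup-concat {n = n} {b = b} χ es _ =
  let es′ , eq = group b n (concat es)
  in cong (blockColour χ) (sym (concat-injective es es′ eq))

blockColour-single : (χ : Colouring k n) → 0 < k → (i : Fin b) (e : Subset n) (∣e∣ : ∣ e ∣ ≡ k) →
                     blockColour χ (single i e) ≡ χ e ∣e∣
blockColour-single {k} {n} {b} χ 0<k i e ∣e∣
  with Fin.any? (λ j → ∣ lookup (single i e) j ∣ ≟ k)
... | no  none = contradiction (i , trans (cong ∣_∣ (lookup∘update i (Vec.replicate b ⊥) e)) ∣e∣) none
... | yes (j , ∣ej∣) with j Fin.≟ i
...   | yes refl = same (lookup∘update i (Vec.replicate b ⊥) e) ∣ej∣
  where
  same : ∀ {e′} → e′ ≡ e → (∣e′∣ : ∣ e′ ∣ ≡ k) → χ e′ ∣e′∣ ≡ χ e ∣e∣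
  same refl ∣e′∣ = cong (χ e) (≡-irrelevant ∣e′∣ ∣e∣)
...   | no  j≢i  = contradiction (trans (sym ∣ej∣) ∣ej∣≡0) (>⇒≢ 0<k)
  where
  ∣ej∣≡0 : ∣ lookup (single i e) j ∣ ≡ 0
  ∣ej∣≡0 = trans (cong ∣_∣ (trans (lookup∘update′ j≢i (Vec.replicate b ⊥) e)
                                  (lookup-replicate j ⊥))) (∣⊥∣≡0 n)

blockColour-mixed : (χ : Colouring k n) (es : Vec (Subset n) b) → All (_< k) (sizes es) →
                    blockColour χ es ≡ hue k (sizes es)
blockColour-mixed {k} χ es es<k with Fin.any? (λ i → ∣ lookup es i ∣ ≟ k)
... | yes (i , ∣e∣) = contradiction ∣e∣ (<⇒≢ (All-sizes⁻ es es<k i))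
... | no  _         = refl

-- Monochromaticity of the blow-up, read blockwise.
blowup-blocks : ∀ {c} (χ : Colouring k n) (Ss : Vec (Subset n) b) →
                Monochromatic (blowup b χ) c (concat Ss) →
                ∀ es → es ⊆ᵇ Ss → sum (sizes es) ≡ k → blockColour χ es ≡ c
blowup-blocks χ Ss mono es es⊆ Σes =
  let ∣es∣ = trans (∣concat∣ es) Σes
  in trans (sym (blowup-concat χ es ∣es∣)) (mono (concat es) ∣es∣ (concat-⊆ es⊆))

-- Either some block of S has m - slack c vertices, and then a subset of it is a clique of χ, or no
-- block is that large, which contradicts ¬mono.
blowup-clique : ∀ {c} (χ : Colouring k n) → 2 ≤ k → Table k c → 2 + k ≤ m → slack c * b < m →
                HasMonochromatic (blowup b χ) c m → HasMonochromatic χ c (m ∸ slack c)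
blowup-clique {k} {n} {m} {b} {c} χ 2≤k table 2+k≤m large (S , ∣S∣ , mono)
  with group b n S
... | Ss , refl with Fin.any? (λ i → m ∸ slack c ≤? ∣ lookup Ss i ∣)
...   | yes (i , t≤) =
  let T , T⊆ , ∣T∣ = shrinkSubset (lookup Ss i) t≤
  in T , ∣T∣ , λ e ∣e∣ e⊆T →
       trans (sym (blockColour-single χ (<⇒≤ 2≤k) i e ∣e∣))
         (blowup-blocks χ Ss mono (single i e) (single-⊆ i Ss (T⊆ ∘ e⊆T))
           (trans (sum-sizes-single i e) ∣e∣))
...   | no none = contradiction mono′ (¬mono 2≤k table
    (subst (2 + k ≤_) m≡Σ 2+k≤m)
    (subst₂ (λ l → slack c * l <_) (sym (length-sizes Ss)) m≡Σ large)
    (subst (λ N → All (λ x → x + suc (slack c) ≤ N) (sizes Ss)) m≡Σ (All-sizes⁺ Ss spread)))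
  where
  m≡Σ : m ≡ sum (sizes Ss)
  m≡Σ = trans (sym ∣S∣) (∣concat∣ Ss)

  slack≤m : slack c ≤ m
  slack≤m = ≤-trans (slack≤2 c) (m+n≤o⇒m≤o 2 2+k≤m)
    where
    slack≤2 : ∀ c → slack c ≤ 2
    slack≤2 red  = s≤s z≤n
    slack≤2 blue = z≤n

  spread : ∀ i → ∣ lookup Ss i ∣ + suc (slack c) ≤ m
  spread i = subst₂ _≤_ (sym (+-suc _ (slack c))) (m∸n+n≡m slack≤m)
    (+-monoˡ-≤ (slack c) (≰⇒> (λ t≤ → none (i , t≤))))

  mono′ : Mono k c (sizes Ss)
  mono′ ν ν≤ Σν ν<k with realise Ss ν≤
  ... | es , es⊆ , refl =
    trans (sym (blockColour-mixed χ es ν<k)) (blowup-blocks χ Ss mono es es⊆ Σν)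

-- The recursive step. A red clique of size 1 + b exceeds the number b of blocks, so its average block
-- size exceeds slack red = 1.
Ramsey-÷ : 2 ≤ k → Table k red → Table k blue → 2 + k ≤ suc b → 2 + k ≤ q →
           Ramsey k (suc b) q (b * n) → Ramsey k b q n
Ramsey-÷ {b = b} 2≤k reds blues 2+k≤1+b 2+k≤q ramsey χ =
  Sum.map
    (blowup-clique {b = b} χ 2≤k reds 2+k≤1+b (subst (_< suc b) (sym (*-identityˡ b)) ≤-refl))
    (blowup-clique {b = b} χ 2≤k blues 2+k≤q (≤-trans (s≤s z≤n) 2+k≤q))
    (ramsey (blowup b χ))

¬Ramsey-0 : ¬ Ramsey k (suc p) (suc q) 0
¬Ramsey-0 ramsey with ramsey (λ _ _ → red)
... | inj₁ (S , ∣S∣ , _) = contradiction (subst (_≤ 0) ∣S∣ (∣p∣≤n S)) λ ()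
... | inj₂ (S , ∣S∣ , _) = contradiction (subst (_≤ 0) ∣S∣ (∣p∣≤n S)) λ ()

-- Decided by evaluation, with k = 5 + j.
tables : ∀ {j} → j < 21 → Table (5 + j) red × Table (5 + j) blue
tables = toWitness {a? = allUpTo? (λ j → table? (5 + j) red ×-dec table? (5 + j) blue) 21} _

theorem2 : ∃[ c ] (c ≥ 25 ×
    (∀ (k : ℕ) → 5 ≤ k → k ≤ c →
    ∀ (p q : ℕ) → p ≥ k + 2 → q ≥ k + 2 →
    ∀ (r r′ : ℕ) → IsRamseyNumber k p q r → IsRamseyNumber k (p ∸ 1) q r′ →
    r ≥ (p ∸ 1) * (r′ ∸ 1) + 1))
theorem2 = 25 , ≤-refl , λ k 5≤k k≤25 p q p≥ q≥ → bound k 5≤k k≤25 p q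
    (subst (_≤ p) (+-comm k 2) p≥) (subst (_≤ q) (+-comm k 2) q≥)
  where
  open IsRamseyNumber

  bound : ∀ k → 5 ≤ k → k ≤ 25 → ∀ p q → 2 + k ≤ p → 2 + k ≤ q →
          ∀ r r′ → IsRamseyNumber k p q r → IsRamseyNumber k (p ∸ 1) q r′ →
          (p ∸ 1) * (r′ ∸ 1) + 1 ≤ r
  bound k 5≤k k≤25 (suc b) (suc q) 2+k≤p@(s≤s (s≤s _)) 2+k≤q r r′ R R′
    with m≤n⇒∃[o]m+o≡n 5≤k
  ... | j , refl = ≮⇒≥ λ r<bn+1 →
    let n = r′ ∸ 1
        reds , blues = tables (+-cancelˡ-≤ 5 (suc j) 21 (≤-trans (≤-reflexive (+-suc 5 j)) (s≤s k≤25)))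
        r≤bn = s≤s⁻¹ (subst (r <_) (+-comm (b * n) 1) r<bn+1)
        ramsey-bn = subst (Ramsey k (suc b) (suc q)) (m+[n∸m]≡n r≤bn)
                      (Ramsey-+ (b * n ∸ r) (ramsey R))
        ramsey-n = Ramsey-÷ (≤-trans (s≤s (s≤s z≤n)) 5≤k) reds blues 2+k≤p 2+k≤q ramsey-bn
    in impossible r′ ramsey-n (minimal R′ n ramsey-n)
    where
    -- With truncated subtraction r′ ≤ r′ ∸ 1 holds for r′ = 0, where n = 0 has no Ramsey property.
    impossible : ∀ {b q} r′ → Ramsey k (suc b) (suc q) (r′ ∸ 1) → ¬ (r′ ≤ r′ ∸ 1)
    impossible zero     ramsey-0 _  = ¬Ramsey-0 ramsey-0
    impossible (suc r′) _        r< = <-irrefl refl r<
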